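{- For all $k \in \mathbb{N}$, we have $\mathcal{P}(\mathbf{J}, n^k) \subsetneq \mathcal{P}(\mathbf{J}, n^{k+1})$. More precisely, for all $k \in \mathbb{N}$ and all $d \in \mathbb{N}$ with $d \leq \lceil k/2 \rceil - 1$, we have $\mathcal{P}(\mathbf{J}_k, n^d) \subsetneq \mathcal{P}(\mathbf{J}_k, n^{d+1})$.
   Context: $\mathbb{N}$ includes $0$; $[n] = \{1, \ldots, n\}$; all alphabets are finite; $n^0 = 1$ for all $n$. Varieties. A variety of monoids is a class of finite monoids closed under submonoids, (finite) Cartesian products and morphic images. The idempotent power of a finite monoid $M$ is the smallest $\omega \in \mathbb{N}_{>0}$ with $x^\omega = x^{2\omega}$ for all $x \in M$. $\mathbf{J}$ is the variety of finite monoids $M$, of idempotent power $\omega$, such that $(xy)^\omega = (xy)^\omega x = y (xy)^\omega$ for all $x, y \in M$. A word $u = u_1 \cdots u_m$ is a subword of $w$ if it is a (not necessarily contiguous) subsequence of $w$. For an alphabet $\Sigma$ and $k \in \mathbb{N}$, $\sim_k$ is the congruence on $\Sigma^*$ defined by $u \sim_k v$ iff $u$ and $v$ have the same set of subwords of length at most $k$. $\mathbf{J}_k$ is the inclusion-wise smallest variety of monoids containing all quotients $\Sigma^* / {\sim_k}$ for all alphabets $\Sigma$. Programs. Let $M$ be a finite monoid, $\Sigma$ an alphabet and $n \in \mathbb{N}$. A program $P$ over $M$ on $\Sigma^n$ is a finite sequence of instructions $(i, f)$ with $i \in [n]$ and $f \colon \Sigma \to M$; its length $|P|$ is its number of instructions.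 On input $w \in \Sigma^n$, instruction $(i, f)$ outputs $f(w_i)$, and $P(w) \in M$ is the product, in order, of the outputs of the instructions. $P$ recognises $L \subseteq \Sigma^n$ if $L = P^{ -1}(F)$ for some $F \subseteq M$. A language $L \subseteq \Sigma^*$ is recognised by a sequence $(P_n)_{n \in \mathbb{N}}$ of programs over one fixed finite monoid $M$ if for each $n$, $P_n$ is a program over $M$ on $\Sigma^n$ recognising $L \cap \Sigma^n$. For a variety of monoids $\mathbf{V}$ and $s \colon \mathbb{N} \to \mathbb{N}$, $\mathcal{P}(\mathbf{V}, s(n))$ is the class of languages (over arbitrary finite alphabets) recognised by some sequence $(P_n)_{n \in \mathbb{N}}$ of programs over some monoid in $\mathbf{V}$ for which there is a real $\alpha > 0$ with $|P_n| \leq \alpha \cdot s(n)$ for all $n \in \mathbb{N}$. -}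

module Defs where

open import Algebra.Bundles using (Monoid)
import Algebra.Construct.DirectProduct as DirectProduct
import Algebra.Construct.Terminal as Terminal
import Algebra.Definitions.RawMonoid as RawMonoidDefs
open import Algebra.Morphism.Structures using (module MonoidMorphisms)
open import Data.Fin.Base using (Fin)
open import Data.Fin.Properties using (*↔×; 1↔⊤)
open import Data.Integer.Base using (+_)
open import Data.List.Base using (List; []; _∷_; _++_; length; map; foldr)
open import Data.List.Properties using (++-assoc; ++-identityʳ; length-++)
open import Data.List.Relation.Binary.Sublist.Propositional
  using ([]; _∷_; _∷ʳ_; ⊆-refl) renaming (_⊆_ to _isSubwordOf_)
open import Data.List.Relation.Binary.Sublist.Propositional.Properties using (++⁺)
open import Data.Nat.Base using (ℕ; _≤_; _<_; _*_)
import Data.Nat.Properties as ℕ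
open import Data.Product.Base using (Σ-syntax; ∃-syntax; _×_; _,_)
open import Data.Product.Function.NonDependent.Setoid using (_×-inverse_)
open import Data.Product.Relation.Binary.Pointwise.NonDependent using (≡×≡⇒≡; ≡⇒≡×≡)
open import Data.Rational.Base using (ℚ; 0ℚ; _/_) renaming (_≤_ to _≤ℚ_; _<_ to _<ℚ_; _*_ to _*ℚ_)
open import Data.Vec.Base using (Vec; lookup; toList)
open import Function.Base using (id)
open import Function.Bundles using (Inverse; Equivalence; _⇔_; mk⇔)
open import Function.Definitions using (Surjective)
import Function.Properties.Equivalence as ⇔
import Function.Properties.Inverse as Inv
open import Level using (Level; 0ℓ; suc; _⊔_)
open import Relation.Binary.Definitions using (_Respects_)
open import Relation.Binary.PropositionalEquality
  using (_≡_; refl; subst; setoid)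
open import Relation.Unary using (Pred; _⊆_)

------------------------------------------------------------------------
-- Finite monoids

IsFinite : Monoid 0ℓ 0ℓ → Set
IsFinite M = ∃[ n ] Inverse (Monoid.setoid M) (setoid (Fin n))

record FiniteMonoid : Set₁ where
  constructor mkFiniteMonoid
  field
    monoid : Monoid 0ℓ 0ℓ
    finite : IsFinite monoid
  open Monoid monoid public

trivialMonoid : FiniteMonoid
trivialMonoid = mkFiniteMonoid Terminal.monoid (1 , record
  { to        = λ _ → Fin.zero
  ; from      = _
  ; to-cong   = λ _ → refl
  ; from-cong = _
  ; inverse   = (λ { {Fin.zero} _ → refl }) , _
  })

_×ᴹ_ : FiniteMonoid → FiniteMonoid → FiniteMonoid
mkFiniteMonoid M (m , f) ×ᴹ mkFiniteMonoid N (n , g) =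
  mkFiniteMonoid (DirectProduct.monoid M N)
    (m * n , Inv.trans (Inv.trans (f ×-inverse g) pointwise) (Inv.sym *↔×))
  where
  pointwise : Inverse _ (setoid (Fin m × Fin n))
  pointwise = record
    { to        = id
    ; from      = id
    ; to-cong   = ≡×≡⇒≡
    ; from-cong = ≡⇒≡×≡
    ; inverse   = ≡×≡⇒≡ , ≡⇒≡×≡
    }

module _ (M N : FiniteMonoid) where
  private
    module M = FiniteMonoid M
    module N = FiniteMonoid N
  open MonoidMorphisms M.rawMonoid N.rawMonoid

  -- M is, up to isomorphism, a submonoid of N.
  Embeds : Set
  Embeds = Σ[ φ ∈ (M.Carrier → N.Carrier) ] IsMonoidMonomorphism φ

  MapsOnto : Set
  MapsOnto = Σ[ φ ∈ (M.Carrier → N.Carrier) ]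
    IsMonoidHomomorphism φ × Surjective M._≈_ N._≈_ φ

------------------------------------------------------------------------
-- Varieties

record IsVariety {ℓ : Level} (V : Pred FiniteMonoid ℓ) : Set (suc 0ℓ ⊔ ℓ) where
  field
    submonoid : ∀ {M N} → Embeds M N → V N → V M
    image     : ∀ {M N} → MapsOnto M N → V M → V N
    trivial   : V trivialMonoid
    product   : ∀ {M N} → V M → V N → V (M ×ᴹ N)

module _ (M : FiniteMonoid) where
  open FiniteMonoid M

  infixr 8 _^ᴹ_
  _^ᴹ_ : Carrier → ℕ → Carrier
  x ^ᴹ n = RawMonoidDefs._×_ rawMonoid n x

  IsIdempotentExponent : ℕ → Set
  IsIdempotentExponent n = 0 < n × (∀ x → x ^ᴹ n ≈ x ^ᴹ (2 * n))

  IsIdempotentPower : ℕ → Set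
  IsIdempotentPower ω =
    IsIdempotentExponent ω × (∀ n → IsIdempotentExponent n → ω ≤ n)

  𝐉 : Set
  𝐉 = Σ[ ω ∈ ℕ ] IsIdempotentPower ω ×
    (∀ x y → (x ∙ y) ^ᴹ ω ≈ (x ∙ y) ^ᴹ ω ∙ x
           × (x ∙ y) ^ᴹ ω ∙ x ≈ y ∙ (x ∙ y) ^ᴹ ω)

------------------------------------------------------------------------
-- The congruences ∼ₖ; the alphabet of size s is Fin s

module _ {s : ℕ} where

  _∼[_]_ : List (Fin s) → ℕ → List (Fin s) → Set
  u ∼[ k ] v = ∀ w → length w ≤ k → w isSubwordOf u ⇔ w isSubwordOf v

  private
    split : ∀ u {v w : List (Fin s)} → w isSubwordOf (u ++ v) →
            Σ[ w₁ ∈ List (Fin s) ] Σ[ w₂ ∈ List (Fin s) ]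
              w ≡ w₁ ++ w₂ × w₁ isSubwordOf u × w₂ isSubwordOf v
    split []      p         = [] , _ , refl , [] , p
    split (a ∷ u) (.a ∷ʳ p) with split u p
    ... | w₁ , w₂ , refl , p₁ , p₂ = w₁ , w₂ , refl , a ∷ʳ p₁ , p₂
    split (a ∷ u) (q ∷ p)   with split u p
    ... | w₁ , w₂ , refl , p₁ , p₂ = _ ∷ w₁ , w₂ , refl , q ∷ p₁ , p₂

    ++-mono : ∀ {k} {u u′ v v′ : List (Fin s)} → u ∼[ k ] u′ → v ∼[ k ] v′ →
              ∀ w → length w ≤ k → w isSubwordOf (u ++ v) → w isSubwordOf (u′ ++ v′)
    ++-mono {k} {u} u∼u′ v∼v′ w |w|≤k p with split u p
    ... | w₁ , w₂ , refl , p₁ , p₂ = ++⁺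
      (Equivalence.to (u∼u′ w₁ (ℕ.m+n≤o⇒m≤o (length w₁) |w₁|+|w₂|≤k)) p₁)
      (Equivalence.to (v∼v′ w₂ (ℕ.m+n≤o⇒n≤o (length w₁) |w₁|+|w₂|≤k)) p₂)
      where |w₁|+|w₂|≤k = subst (_≤ k) (length-++ w₁) |w|≤k

  ∼-refl : ∀ {k u} → u ∼[ k ] u
  ∼-refl w _ = ⇔.refl

  ∼-sym : ∀ {k u v} → u ∼[ k ] v → v ∼[ k ] u
  ∼-sym u∼v w |w|≤k = ⇔.sym (u∼v w |w|≤k)

  ∼-trans : ∀ {k u v t} → u ∼[ k ] v → v ∼[ k ] t → u ∼[ k ] t
  ∼-trans u∼v v∼t w |w|≤k = ⇔.trans (u∼v w |w|≤k) (v∼t w |w|≤k)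

  ∼-reflexive : ∀ {k u v} → u ≡ v → u ∼[ k ] v
  ∼-reflexive refl = ∼-refl

  ++-cong : ∀ {k} {u u′ v v′ : List (Fin s)} →
            u ∼[ k ] u′ → v ∼[ k ] v′ → (u ++ v) ∼[ k ] (u′ ++ v′)
  ++-cong {u = u} {u′} u∼u′ v∼v′ w |w|≤k = mk⇔
    (++-mono {u = u} u∼u′ v∼v′ w |w|≤k)
    (++-mono {u = u′} (∼-sym u∼u′) (∼-sym v∼v′) w |w|≤k)

[Fin_]*/∼_ : ℕ → ℕ → Monoid 0ℓ 0ℓ
[Fin s ]*/∼ k = record
  { Carrier  = List (Fin s)
  ; _≈_      = _∼[ k ]_
  ; _∙_      = _++_
  ; ε        = []
  ; isMonoid = record
    { isSemigroup = record
      { isMagma = record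
        { isEquivalence = record { refl = ∼-refl ; sym = ∼-sym ; trans = ∼-trans }
        ; ∙-cong        = ++-cong
        }
      ; assoc = λ u v t → ∼-reflexive (++-assoc u v t)
      }
    ; identity = (λ _ → ∼-refl) , (λ u → ∼-reflexive (++-identityʳ u))
    }
  }

-- These quotients are all finite; which witness fin is used is immaterial, as
-- varieties are closed under isomorphism.
ContainsQuotients : {ℓ : Level} → ℕ → Pred FiniteMonoid ℓ → Set ℓ
ContainsQuotients k V =
  ∀ s (fin : IsFinite ([Fin s ]*/∼ k)) → V (mkFiniteMonoid ([Fin s ]*/∼ k) fin)

-- The smallest variety containing the quotients, generated inductively; the
-- two facts below say that it is that smallest variety.
data 𝐉[_] (k : ℕ) : Pred FiniteMonoid (suc 0ℓ) where
  quotient  : ContainsQuotients k 𝐉[ k ]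
  submonoid : ∀ {M N} → Embeds M N → 𝐉[ k ] N → 𝐉[ k ] M
  image     : ∀ {M N} → MapsOnto M N → 𝐉[ k ] M → 𝐉[ k ] N
  trivial   : 𝐉[ k ] trivialMonoid
  product   : ∀ {M N} → 𝐉[ k ] M → 𝐉[ k ] N → 𝐉[ k ] (M ×ᴹ N)

𝐉[]-isVariety : ∀ k → IsVariety 𝐉[ k ]
𝐉[]-isVariety k = record
  { submonoid = submonoid
  ; image     = image
  ; trivial   = trivial
  ; product   = product
  }

𝐉[]-smallest : ∀ {ℓ} k (V : Pred FiniteMonoid ℓ) →
               IsVariety V → ContainsQuotients k V → 𝐉[ k ] ⊆ V
𝐉[]-smallest k V isVar gen = go
  where
  module V = IsVariety isVar
  go : 𝐉[ k ] ⊆ V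
  go (quotient s fin) = gen s fin
  go (submonoid e p)  = V.submonoid e (go p)
  go (image e p)      = V.image e (go p)
  go trivial          = V.trivial
  go (product p q)    = V.product (go p) (go q)

------------------------------------------------------------------------
-- Programs

record Language : Set₁ where
  constructor mkLanguage
  field
    size  : ℕ
    words : Pred (List (Fin size)) 0ℓ

module _ (M : FiniteMonoid) (s n : ℕ) where
  open FiniteMonoid M

  Instruction : Set
  Instruction = Fin n × (Fin s → Carrier)

  Program : Set
  Program = List Instruction

  output : Vec (Fin s) n → Instruction → Carrier
  output w (i , f) = f (lookup w i)

  run : Program → Vec (Fin s) n → Carrier
  run P w = foldr _∙_ ε (map (output w) P)

  -- Respects _≈_ makes F a subset of the monoid, not of its representatives.
  Recognises : Program → Pred (List (Fin s)) 0ℓ → Set₁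
  Recognises P L = Σ[ F ∈ Pred Carrier 0ℓ ] F Respects _≈_ ×
    (∀ (w : Vec (Fin s) n) → L (toList w) ⇔ F (run P w))

-- A rational constant α loses nothing against a real one, since every real is
-- bounded above by a rational and the bounds s n are nonnegative.
𝒫 : {ℓ : Level} → Pred FiniteMonoid ℓ → (ℕ → ℕ) → Pred Language (suc 0ℓ ⊔ ℓ)
𝒫 V s (mkLanguage a L) =
  Σ[ M ∈ FiniteMonoid ] V M ×
  Σ[ P ∈ (∀ n → Program M a n) ]
    (∀ n → Recognises M a n (P n) L) ×
    (Σ[ α ∈ ℚ ] 0ℚ <ℚ α × (∀ n → (+ length (P n) / 1) ≤ℚ α *ℚ (+ s n / 1)))

{-# OPTIONS --safe #-}
module Submission where

-- A selector is a set σ ⊆ [q]^(d+1). Cut an input of length n into d+1 blocks of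
-- length q, linear in n, and look at inputs carrying a single 1 in each block,
-- at positions t. A program that lets coordinate c write the letter b_c before
-- and after running through the coordinates after c writes
-- b_0 b_1 … b_d … b_1 b_0 as a subword exactly when σ contains t; this takes
-- O(n^(d+1)) instructions and reads subwords of length 2d+1 ≤ k.
--
-- There are 2^Θ(n^(d+1)) selectors, but programs of length O(n^d) over one finite
-- monoid compute only 2^O(n^d log n) functions. A selector missed by all
-- programs of length n^d log n over log n states is found by searching a finite
-- set whenever counting provides one (otherwise the empty selector is taken), so
-- the hard language is defined without any choice.

open import Defs
open import Data.Integer using (+_; _-_; 1ℤ) renaming (_≤_ to _≤ᶻ_)
open import Data.Nat using (ℕ; _^_; suc; ⌈_/2⌉)
open import Data.Product using (_×_)
open import Relation.Unary using (_⊂_)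

open import Algebra.Bundles using (Monoid)
import Algebra.Properties.Monoid.Mult as Mult
open import Data.Fin.Base as Fin
  using (Fin; zero; suc; toℕ; combine; finToFun; funToFin; remainder; inject≤; fromℕ<)
open import Data.Fin.Properties
  using (_≟_; any?; ¬∀⟶∃¬; suc-injective; 0≢1+n; sequence; <⇒notInjective; inject≤-injective;
         combine-injective; combine-remQuot; remQuot-combine; finToFun-funToFin; funToFin-finToFin)
open import Data.Integer using (∣_∣)
import Data.Integer as ℤ
import Data.Integer.Properties as ℤ
open import Data.List.Base as List
  using (List; []; _∷_; [_]; _++_; length; concat; concatMap; tabulate; replicate;
         cartesianProductWith; allFin; filter)
open import Data.List.Membership.Propositional using (_∈_)
open import Data.List.Membership.Propositional.Properties
  using (∈-allFin; ∈-filter⁺; ∈-filter⁻; ∈-lookup; ∈-cartesianProductWith⁺; ∈-++⁺ʳ)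
open import Data.List.Properties
  using (concatMap-++; length-++; length-replicate; ++-assoc; ++-identityʳ;
         tabulate-cong)
import Data.List.Relation.Binary.Sublist.DecPropositional as DecSublist
open import Data.List.Relation.Binary.Sublist.Propositional
  using ([]; _∷_; _∷ʳ_; ⊆-refl; ⊆-trans; to∈; minimum) renaming (_⊆_ to _⊑_)
open import Data.List.Relation.Binary.Sublist.Propositional.Properties using (++⁺; ++⁺ʳ; ++⁺ˡ; ∷⁻)
open import Data.List.Relation.Unary.All as All using (All; []; _∷_)
import Data.List.Relation.Unary.All.Properties as All
open import Data.List.Relation.Unary.AllPairs using ([]; _∷_)
open import Data.List.Relation.Unary.Any using (here; index)
open import Data.List.Relation.Unary.Any.Properties using (lookup-index)
open import Data.List.Relation.Unary.Unique.Propositional using (Unique)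
import Data.List.Relation.Unary.Unique.Propositional.Properties as Unique
open import Data.Nat
  using (zero; _+_; _*_; _∸_; _/_; _≤_; _<_; _<?_; z≤n; s≤s; NonZero; >-nonZero)
open import Data.Nat.DivMod using (m*n/n≡m; m/n*n≤m; m/n≤m)
open import Data.Nat.Induction using (<-rec)
open import Data.Nat.Logarithm using (⌊log₂_⌋; ⌊log₂[2^n]⌋≡n)
import Data.Nat.Properties as ℕ
open import Data.Nat.Tactic.RingSolver using (solve-∀)
open import Algebra.Properties.CommutativeSemigroup ℕ.*-commutativeSemigroup using (x∙yz≈y∙xz)
open import Data.Product using (Σ; Σ-syntax; ∃; ∃₂; _,_; proj₁; proj₂)
open import Data.Rational using (ℚ; mkℚ; 0ℚ; ↥_; toℚᵘ)
  renaming (_≤_ to _≤ℚ_; _<_ to _<ℚ_; _*_ to _*ℚ_; _/_ to _/ℚ_)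
import Data.Rational.Properties as ℚ
open import Data.Rational.Unnormalised using (mkℚᵘ; *≤*) renaming (_≤_ to _≤ᵘ_; _*_ to _*ᵘ_)
import Data.Rational.Unnormalised.Properties as ℚᵘ
open import Data.Vec.Base as Vec using (Vec; lookup; toList; fromList)
open import Data.Vec.Properties using (lookup∘tabulate)
open import Effect.Monad using (RawMonad)
open import Function using (_∘_; id; Injective; Inverse; Equivalence; _⇔_; mk⇔)
import Function.Properties.Equivalence as ⇔
open import Level using (Level; 0ℓ)
open import Relation.Binary.Bundles using (Setoid)
open import Relation.Binary.Definitions using (_Respects_)
open import Relation.Binary.PropositionalEquality hiding ([_])
open import Relation.Nullary using (¬_; Dec; yes; no; contradiction)
open import Relation.Nullary.Decidable using (_×-dec_; ¬¬-excluded-middle)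
open import Relation.Nullary.Negation using (¬¬-Monad; ¬¬-map)
open import Relation.Unary using (Pred; _⊆_)

private variable
  a : Level
  A : Set a
  d n q s : ℕ

-- Subwords and absent letters

infix 4 _#_
_#_ : A → List A → Set _
x # xs = All (x ≢_) xs

skip-prefix : ∀ {b : A} {v} X {Y} → b # X → b ∷ v ⊑ X ++ Y → b ∷ v ⊑ Y
skip-prefix []      []          p          = p
skip-prefix (x ∷ X) (_ ∷ b∉X)   (_ ∷ʳ p)   = skip-prefix X b∉X p
skip-prefix (x ∷ X) (b≢x ∷ b∉X) (refl ∷ p) = contradiction refl b≢x

-- The final `b` cannot be matched inside `Y`, so it is matched at the displayed `b` or earlier, and
-- `u` is matched before it.
skip-suffix : ∀ {b : A} {Y} → b # Y → ∀ u X → u ++ [ b ] ⊑ X ++ b ∷ Y → u ⊑ X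
skip-suffix b∉Y []      X       p          = minimum X
skip-suffix b∉Y (x ∷ u) []      p          =
  contradiction refl (All.lookup b∉Y (to∈ (⊆-trans (++⁺ˡ u ⊆-refl) (∷⁻ p))))
skip-suffix b∉Y (x ∷ u) (y ∷ X) (_ ∷ʳ p)   = y ∷ʳ skip-suffix b∉Y (x ∷ u) X p
skip-suffix b∉Y (x ∷ u) (_ ∷ X) (refl ∷ p) = refl ∷ skip-suffix b∉Y u X p

concat-tabulate-split : ∀ {b : A} (f : Fin n → List A) i → (∀ j → j ≢ i → b # f j) →
  ∃₂ λ X Y → b # X × b # Y × concat (tabulate f) ≡ X ++ f i ++ Y
concat-tabulate-split f zero    b∉ =
  [] , _ , [] , All.concat⁺ (All.tabulate⁺ λ j → b∉ (suc j) λ ()) , refl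
concat-tabulate-split f (suc i) b∉
  with X , Y , b∉X , b∉Y , eq ←
         concat-tabulate-split (f ∘ suc) i (λ j j≢i → b∉ (suc j) (j≢i ∘ suc-injective))
  = f zero ++ X , Y , All.++⁺ (b∉ zero 0≢1+n) b∉X , b∉Y
  , trans (cong (f zero ++_) eq) (sym (++-assoc (f zero) X _))

concatMap-concat-tabulate : ∀ {b} {B : Set b} (g : A → List B) (f : Fin n → List A) →
  concatMap g (concat (tabulate f)) ≡ concat (tabulate (concatMap g ∘ f))
concatMap-concat-tabulate {n = zero}  g f = refl
concatMap-concat-tabulate {n = suc n} g f = trans
  (concatMap-++ g (f zero) _)
  (cong (concatMap g (f zero) ++_) (concatMap-concat-tabulate g (f ∘ suc)))

length-concat-tabulate-≤ : ∀ {c} (f : Fin n → List A) → (∀ i → length (f i) ≤ c) →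
  length (concat (tabulate f)) ≤ n * c
length-concat-tabulate-≤ {n = zero}  f |f|≤c = z≤n
length-concat-tabulate-≤ {n = suc n} f |f|≤c = ℕ.≤-trans
  (ℕ.≤-reflexive (length-++ (f zero)))
  (ℕ.+-mono-≤ (|f|≤c zero) (length-concat-tabulate-≤ (f ∘ suc) (|f|≤c ∘ suc)))

-- Selector programs

nest : ∀ d → (Fin (suc d) → A) → List A
nest zero    b = [ b zero ]
nest (suc d) b = b zero ∷ nest d (b ∘ suc) ++ [ b zero ]

length-nest : ∀ d (b : Fin (suc d) → A) → length (nest d b) ≡ suc (d + d)
length-nest zero    b = refl
length-nest (suc d) b = cong suc (begin
  length (nest d (b ∘ suc) ++ [ b zero ])  ≡⟨ length-++ (nest d (b ∘ suc)) ⟩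
  length (nest d (b ∘ suc)) + 1            ≡⟨ cong (_+ 1) (length-nest d (b ∘ suc)) ⟩
  suc (d + d) + 1                          ≡⟨ ℕ.+-comm (suc (d + d)) 1 ⟩
  suc (suc (d + d))                        ≡⟨ cong suc (ℕ.+-suc d d) ⟨
  suc (d + suc d)                          ∎)
  where open ≡-Reasoning

emit : A → Fin 2 → List A
emit b x = replicate (toℕ x) b

sandwich : Fin n → A → List (Fin n × (Fin 2 → List A)) → List (Fin n × (Fin 2 → List A))
sandwich i b P = (i , emit b) ∷ P ++ [ i , emit b ]

-- `σ ∘ combine i` is the section of `σ` at first coordinate `i`. Only the innermost level consults
-- `σ`, by keeping or dropping an instruction: the selector is wired into the program.
selector : ∀ d → (Fin (suc d) → Fin q → Fin n) → (Fin (suc d) → A) →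
           (Fin (q ^ suc d) → Fin 2) → List (Fin n × (Fin 2 → List A))
selector zero    pos b σ = concat (tabulate λ i →
  replicate (toℕ (σ (combine i zero))) (pos zero i , emit (b zero)))
selector (suc d) pos b σ = concat (tabulate λ i →
  sandwich (pos zero i) (b zero) (selector d (pos ∘ suc) (b ∘ suc) (σ ∘ combine i)))

outputs : Vec (Fin 2) n → List (Fin n × (Fin 2 → List A)) → List A
outputs w = concatMap λ (i , f) → f (lookup w i)

-- Each of the d outer coordinates costs two instructions on at most `q ^ suc d` branches and the
-- innermost one at most one, hence the factor 2d + 1.
length-selector : ∀ d (pos : Fin (suc d) → Fin q → Fin n) (b : Fin (suc d) → A) σ →
                  length (selector d pos b σ) ≤ suc (d + d) * q ^ suc d
length-selector {q = q} zero    pos b σ = ℕ.≤-trans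
  (length-concat-tabulate-≤ (λ i → replicate (toℕ (σ (combine i zero))) (pos zero i , emit (b zero)))
    λ i → ℕ.≤-trans (ℕ.≤-reflexive (length-replicate (toℕ (σ (combine i zero))))) (toℕ≤1 _))
  (ℕ.≤-reflexive (sym (ℕ.*-identityˡ (q * 1))))
  where
  toℕ≤1 : ∀ (x : Fin 2) → toℕ x ≤ 1
  toℕ≤1 zero       = z≤n
  toℕ≤1 (suc zero) = s≤s z≤n
length-selector {q = zero} (suc d) pos b σ = z≤n
length-selector {q = q@(suc _)} (suc d) pos b σ = begin
  length (selector (suc d) pos b σ)
    ≤⟨ length-concat-tabulate-≤ block length-block ⟩
  q * (2 * q ^ suc d + suc (d + d) * q ^ suc d)
    ≡⟨ cong (q *_) (ℕ.*-distribʳ-+ (q ^ suc d) 2 (suc (d + d))) ⟨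
  q * ((2 + suc (d + d)) * q ^ suc d)
    ≡⟨ cong (λ c → q * (suc (suc c) * q ^ suc d)) (ℕ.+-suc d d) ⟨
  q * (suc (suc d + suc d) * q ^ suc d)
    ≡⟨ x∙yz≈y∙xz q (suc (suc d + suc d)) (q ^ suc d) ⟩
  suc (suc d + suc d) * (q * q ^ suc d) ∎
  where
  open ℕ.≤-Reasoning
  inner = λ i → selector d (pos ∘ suc) (b ∘ suc) (σ ∘ combine i)
  block = λ i → sandwich (pos zero i) (b zero) (inner i)
  length-block : ∀ i → length (block i) ≤ 2 * q ^ suc d + suc (d + d) * q ^ suc d
  length-block i = begin
    length (block i)
      ≡⟨ cong suc (length-++ (inner i)) ⟩
    suc (length (inner i) + 1)
      ≡⟨ cong suc (ℕ.+-comm (length (inner i)) 1) ⟩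
    2 + length (inner i)
      ≤⟨ ℕ.+-mono-≤ (ℕ.*-monoʳ-≤ 2 (ℕ.m^n>0 q (suc d))) (length-selector d _ _ _) ⟩
    2 * q ^ suc d + suc (d + d) * q ^ suc d ∎

emit-fresh : ∀ {b c : A} → b ≢ c → ∀ x → b # emit c x
emit-fresh b≢c x = All.replicate⁺ (toℕ x) b≢c

outputs-replicate : ∀ (w : Vec (Fin 2) n) k i (f : Fin 2 → List A) →
  outputs w (replicate k (i , f)) ≡ concat (replicate k (f (lookup w i)))
outputs-replicate w zero    i f = refl
outputs-replicate w (suc k) i f = cong (f (lookup w i) ++_) (outputs-replicate w k i f)

outputs-sandwich : ∀ (w : Vec (Fin 2) n) (b : A) i P →
  outputs w (sandwich i b P)
    ≡ emit b (lookup w i) ++ outputs w P ++ emit b (lookup w i)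
outputs-sandwich w b i P = cong (emit b (lookup w i) ++_) (trans
  (concatMap-++ _ P [ i , emit b ])
  (cong (outputs w P ++_) (++-identityʳ _)))

outputs-selector-zero : ∀ (w : Vec (Fin 2) n) (pos : Fin 1 → Fin q → Fin n) (b : _ → A) σ →
  outputs w (selector zero pos b σ) ≡ concat (tabulate λ i →
    concat (replicate (toℕ (σ (combine i zero))) (emit (b zero) (lookup w (pos zero i)))))
outputs-selector-zero w pos b σ = trans
  (concatMap-concat-tabulate (λ (i , f) → f (lookup w i))
    (λ i → replicate (toℕ (σ (combine i zero))) (pos zero i , emit (b zero))))
  (cong concat (tabulate-cong λ i →
    outputs-replicate w (toℕ (σ (combine i zero))) (pos zero i) (emit (b zero))))

outputs-selector-suc : ∀ (w : Vec (Fin 2) n) (pos : Fin (suc (suc d)) → Fin q → Fin n) (b : _ → A) σ →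
  outputs w (selector (suc d) pos b σ) ≡ concat (tabulate λ i →
    emit (b zero) (lookup w (pos zero i)) ++
    outputs w (selector d (pos ∘ suc) (b ∘ suc) (σ ∘ combine i)) ++
    emit (b zero) (lookup w (pos zero i)))
outputs-selector-suc {d = d} w pos b σ = trans
  (concatMap-concat-tabulate (λ (i , f) → f (lookup w i))
    (λ i → sandwich (pos zero i) (b zero) (selector d (pos ∘ suc) (b ∘ suc) (σ ∘ combine i))))
  (cong concat (tabulate-cong λ i → outputs-sandwich w (b zero) (pos zero i)
    (selector d (pos ∘ suc) (b ∘ suc) (σ ∘ combine i))))

outputs-selector-fresh : ∀ d (w : Vec (Fin 2) n) (pos : Fin (suc d) → Fin q → Fin n) (b : _ → A) σ {c} →
  (∀ i → c ≢ b i) → c # outputs w (selector d pos b σ)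
outputs-selector-fresh zero w pos b σ {c} c≢b =
  subst (c #_) (sym (outputs-selector-zero w pos b σ))
    (All.concat⁺ (All.tabulate⁺ λ i → All.concat⁺ (All.replicate⁺ (toℕ (σ (combine i zero)))
      (emit-fresh (c≢b zero) (lookup w (pos zero i))))))
outputs-selector-fresh (suc d) w pos b σ {c} c≢b =
  subst (c #_) (sym (outputs-selector-suc w pos b σ))
    (All.concat⁺ (All.tabulate⁺ λ i → All.++⁺ (fresh i) (All.++⁺
      (outputs-selector-fresh d w (pos ∘ suc) (b ∘ suc) (σ ∘ combine i) (c≢b ∘ suc))
      (fresh i))))
  where
  fresh : ∀ i → c # emit (b zero) (lookup w (pos zero i))
  fresh i = emit-fresh (c≢b zero) (lookup w (pos zero i))

-- The input w has its only 1 of each block c at the c-th coordinate of t.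
record Marks (w : Vec (Fin 2) n) (pos : Fin d → Fin q → Fin n) (t : Fin (q ^ d)) : Set where
  field
    marked   : ∀ c → lookup w (pos c (finToFun t c)) ≡ suc zero
    unmarked : ∀ c i → i ≢ finToFun t c → lookup w (pos c i) ≡ zero

open Marks

marks-tail : ∀ {w : Vec (Fin 2) n} {pos : Fin (suc d) → Fin q → Fin n} {t} →
  Marks w pos t → Marks w (pos ∘ suc) (remainder {q} (q ^ d) t)
marks-tail m = record { marked = marked m ∘ suc ; unmarked = unmarked m ∘ suc }

combine-zero : ∀ {q} (t : Fin (q * 1)) → combine (Fin.quotient {q} 1 t) zero ≡ t
combine-zero {q} t with remainder {q} 1 t | combine-remQuot {q} 1 t
... | zero | eq = eq

-- By `Marks`, only the block at the first coordinate of `t` writes `b zero`. So the first letter of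
-- the nest is not matched before this block and the last not after it; the inner nest then lies
-- inside the block, where induction applies to a section of `σ`. An opening letter alone would let
-- the inner letters be matched in later blocks, which follow other sections.
selector-correct : ∀ d (w : Vec (Fin 2) n) (pos : Fin (suc d) → Fin q → Fin n) (b : _ → A) σ t →
  Injective _≡_ _≡_ b → Marks w pos t →
  nest d b ⊑ outputs w (selector d pos b σ) ⇔ σ t ≡ suc zero
selector-correct {q = q} zero w pos b σ t b-inj m
  with X , Y , b∉X , b∉Y , eq ← concat-tabulate-split {b = b zero} (λ i →
         concat (replicate (toℕ (σ (combine i zero))) (emit (b zero) (lookup w (pos zero i)))))
         (Fin.quotient {q} 1 t)
         (λ i i≢ → subst
           (λ x → b zero # concat (replicate (toℕ (σ (combine i zero))) (emit (b zero) x)))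
           (sym (unmarked m zero i i≢))
           (All.concat⁺ (All.replicate⁺ (toℕ (σ (combine i zero))) [])))
  rewrite outputs-selector-zero w pos b σ | eq | marked m zero | combine-zero {q} t
  = mk⇔ only-if if
  where
  only-if : [ b zero ] ⊑ X ++ concat (replicate (toℕ (σ t)) [ b zero ]) ++ Y → σ t ≡ suc zero
  only-if p with σ t
  ... | suc zero = refl
  ... | zero     = contradiction refl (All.lookup (All.++⁺ b∉X b∉Y) (to∈ p))
  if : σ t ≡ suc zero → [ b zero ] ⊑ X ++ concat (replicate (toℕ (σ t)) [ b zero ]) ++ Y
  if eq rewrite eq = ++⁺ˡ X (refl ∷ minimum Y)
selector-correct {q = q} (suc d) w pos b σ t b-inj m
  with X , Y , b∉X , b∉Y , eq ← concat-tabulate-split {b = b zero} (λ i →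
         emit (b zero) (lookup w (pos zero i)) ++
         outputs w (selector d (pos ∘ suc) (b ∘ suc) (σ ∘ combine i)) ++
         emit (b zero) (lookup w (pos zero i)))
         (Fin.quotient {q} (q ^ suc d) t)
         -- At an unmarked position both flanking letters vanish, and by injectivity of `b` the
         -- inner levels write only other letters.
         (λ i i≢ → subst
           (λ x → b zero # (emit (b zero) x ++
                            outputs w (selector d (pos ∘ suc) (b ∘ suc) (σ ∘ combine i)) ++
                            emit (b zero) x))
           (sym (unmarked m zero i i≢))
           (All.++⁺ (outputs-selector-fresh d w (pos ∘ suc) (b ∘ suc) (σ ∘ combine i)
                      (λ i → 0≢1+n ∘ b-inj))
                    []))
  rewrite outputs-selector-suc w pos b σ | eq | marked m zero
  with ih ← selector-correct d w (pos ∘ suc) (b ∘ suc)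
              (σ ∘ combine (Fin.quotient {q} (q ^ suc d) t)) (remainder {q} (q ^ suc d) t)
              (suc-injective ∘ b-inj) (marks-tail {w = w} {pos = pos} m)
  -- The section of `σ` at the remaining coordinates of `t` takes the value `σ t`.
  rewrite combine-remQuot {q} (q ^ suc d) t
  = mk⇔ (λ p → Equivalence.to ih (skip-suffix b∉Y _ inner
            (subst (_ ⊑_) (++-assoc inner _ _) (∷⁻ (skip-prefix X b∉X p)))))
        (λ σt → ++⁺ˡ X (++⁺ʳ Y (refl ∷ ++⁺ (Equivalence.from ih σt) ⊆-refl)))
  where
  inner = outputs w (selector d (pos ∘ suc) (b ∘ suc) (σ ∘ combine (Fin.quotient {q} (q ^ suc d) t)))

-- Finiteness of the quotients

lookup-injective : ∀ {a} {A : Set a} {xs : List A} → Unique xs →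
  ∀ i j → List.lookup xs i ≡ List.lookup xs j → i ≡ j
lookup-injective (x≢ ∷ u) zero    zero    eq = refl
lookup-injective (x≢ ∷ u) zero    (suc j) eq = contradiction eq (All.lookup x≢ (∈-lookup j))
lookup-injective (x≢ ∷ u) (suc i) zero    eq = contradiction (sym eq) (All.lookup x≢ (∈-lookup i))
lookup-injective (x≢ ∷ u) (suc i) (suc j) eq = cong suc (lookup-injective u i j eq)

module _ (S : Setoid 0ℓ 0ℓ) where
  open Setoid S using (Carrier; _≈_)

  -- The values of `h`, listed without repetition, number the classes; an index is sent back to a
  -- preimage of its value.
  finite-if-image-decidable : ∀ {n} (h : Carrier → Fin n) →
    (∀ {x y} → x ≈ y → h x ≡ h y) → (∀ {x y} → h x ≡ h y → x ≈ y) →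
    (∀ i → Dec (∃ λ x → h x ≡ i)) → ∃ λ m → Inverse S (setoid (Fin m))
  finite-if-image-decidable {n} h h-cong h-inj hits? = length hits , record
    { to        = λ x → index (h∈ x)
    ; from      = λ i → proj₁ (preimage i)
    ; to-cong   = λ {x} {y} x≈y → lookup-injective hits-unique _ _
                    (trans (sym (lookup-index (h∈ x))) (trans (h-cong x≈y) (lookup-index (h∈ y))))
    ; from-cong = λ { refl → Setoid.refl S }
    ; inverse   = (λ {i} {x} x≈ → lookup-injective hits-unique _ _
                    (trans (sym (lookup-index (h∈ x))) (trans (h-cong x≈) (proj₂ (preimage i)))))
                , (λ {x} eq → h-inj (trans (proj₂ (preimage _))
                    (trans (cong (List.lookup hits) eq) (sym (lookup-index (h∈ x))))))
    }
    where
    hits = filter hits? (allFin n)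
    hits-unique : Unique hits
    hits-unique = Unique.filter⁺ hits? (Unique.allFin⁺ n)
    h∈ : ∀ x → h x ∈ hits
    h∈ x = ∈-filter⁺ hits? (∈-allFin (h x)) (x , refl)
    preimage : ∀ i → ∃ λ x → h x ≡ List.lookup hits i
    preimage i = proj₂ (∈-filter⁻ hits? {xs = allFin n} (∈-lookup i))

  -- Deciding which values h takes is avoidable: the strict inclusions are negations.
  ¬¬-finite : ∀ {n} (h : Carrier → Fin n) →
    (∀ {x y} → x ≈ y → h x ≡ h y) → (∀ {x y} → h x ≡ h y → x ≈ y) →
    ¬ ¬ (∃ λ m → Inverse S (setoid (Fin m)))
  ¬¬-finite h h-cong h-inj = ¬¬-map (finite-if-image-decidable h h-cong h-inj)
    (sequence (RawMonad.rawApplicative ¬¬-Monad) λ i → ¬¬-excluded-middle)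

funToFin-cong : ∀ {m n} {f g : Fin m → Fin n} → f ≗ g → funToFin f ≡ funToFin g
funToFin-cong {zero}  f≗g = refl
funToFin-cong {suc m} f≗g = cong₂ combine (f≗g zero) (funToFin-cong (f≗g ∘ suc))

words≤ : ∀ s → ℕ → List (List (Fin s))
words≤ s zero    = [ [] ]
words≤ s (suc k) = [] ∷ cartesianProductWith _∷_ (allFin s) (words≤ s k)

∈-words≤ : ∀ {s k} (w : List (Fin s)) → length w ≤ k → w ∈ words≤ s k
∈-words≤ {k = zero}  []      _         = here refl
∈-words≤ {k = suc k} []      _         = here refl
∈-words≤ {k = suc k} (a ∷ w) (s≤s |w|≤k) =
  ∈-++⁺ʳ [ [] ] (∈-cartesianProductWith⁺ _∷_ (∈-allFin a) (∈-words≤ w |w|≤k))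

length-words≤ : ∀ s k → All (λ w → length w ≤ k) (words≤ s k)
length-words≤ s zero    = z≤n ∷ []
length-words≤ s (suc k) = z≤n ∷
  All.cartesianProductWith⁺ (setoid _) (setoid _) _∷_ (allFin s) (words≤ s k)
    (λ _ w∈ → s≤s (All.lookup (length-words≤ s k) w∈))

fromDec : {P : Set} → Dec P → Fin 2
fromDec (yes _) = suc zero
fromDec (no  _) = zero

fromDec-cong : ∀ {P Q : Set} (p? : Dec P) (q? : Dec Q) → P ⇔ Q → fromDec p? ≡ fromDec q?
fromDec-cong (yes p) (yes q) _   = refl
fromDec-cong (yes p) (no ¬q) p⇔q = contradiction (Equivalence.to p⇔q p) ¬q
fromDec-cong (no ¬p) (yes q) p⇔q = contradiction (Equivalence.from p⇔q q) ¬p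
fromDec-cong (no ¬p) (no ¬q) _   = refl

fromDec-inj : ∀ {P Q : Set} (p? : Dec P) (q? : Dec Q) → fromDec p? ≡ fromDec q? → P → Q
fromDec-inj p?      (yes q) _  _ = q
fromDec-inj (no ¬p) (no ¬q) _  p = contradiction p ¬p

module _ (s k : ℕ) where
  open DecSublist (_≟_ {s}) using (_⊆?_)
  private
    W = words≤ s k

    bits : List (Fin s) → Fin (length W) → Fin 2
    bits u i = fromDec (List.lookup W i ⊆? u)

    profile : List (Fin s) → Fin (2 ^ length W)
    profile u = funToFin (bits u)

    profile-cong : ∀ {u v} → u ∼[ k ] v → profile u ≡ profile v
    profile-cong {u} {v} u∼v = funToFin-cong λ i →
      fromDec-cong (List.lookup W i ⊆? u) (List.lookup W i ⊆? v)
        (u∼v _ (All.lookup (length-words≤ s k) (∈-lookup i)))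

    profile-mono : ∀ {u v} → profile u ≡ profile v → ∀ w → length w ≤ k → w ⊑ u → w ⊑ v
    profile-mono {u} {v} eq w |w|≤k w⊑u = subst (_⊑ v) (sym (lookup-index w∈))
      (fromDec-inj (_ ⊆? u) (_ ⊆? v) bits-agree (subst (_⊑ u) (lookup-index w∈) w⊑u))
      where
      w∈ = ∈-words≤ w |w|≤k
      i = index w∈
      bits-agree : bits u i ≡ bits v i
      bits-agree = trans (sym (finToFun-funToFin (bits u) i))
        (trans (cong (λ x → finToFun x i) eq) (finToFun-funToFin (bits v) i))

  -- A class is determined by the bit vector telling which of the finitely many words of length at
  -- most `k` are subwords.
  quotient-¬¬-finite : ¬ ¬ IsFinite ([Fin s ]*/∼ k)
  quotient-¬¬-finite = ¬¬-finite (Monoid.setoid ([Fin s ]*/∼ k)) profile profile-cong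
    (λ eq w |w|≤k → mk⇔ (profile-mono eq w |w|≤k) (profile-mono (sym eq) w |w|≤k))

-- Membership of the quotients in `𝐉`

-- `P` need not be decidable, whence the double negation: without a least element, strong induction
-- refutes `P` everywhere.
¬¬-least : ∀ {p} {P : Pred ℕ p} n → P n → ¬ ¬ (Σ[ m ∈ ℕ ] P m × (∀ j → P j → m ≤ j))
¬¬-least {P = P} = <-rec (λ n → P n → _) λ n rec Pn none →
  none (n , Pn , λ j Pj → ℕ.≮⇒≥ λ j<n → rec j<n Pj none)

++-split : ∀ {a} {A : Set a} (u : List A) {v w} → w ⊑ u ++ v →
  ∃₂ λ w₁ w₂ → w ≡ w₁ ++ w₂ × w₁ ⊑ u × w₂ ⊑ v
++-split []      p           = [] , _ , refl , [] , p
++-split (a ∷ u) (.a ∷ʳ p)   with w₁ , w₂ , eq , p₁ , p₂ ← ++-split u p =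
  w₁ , w₂ , eq , a ∷ʳ p₁ , p₂
++-split (a ∷ u) (refl ∷ p)  with w₁ , w₂ , eq , p₁ , p₂ ← ++-split u p =
  a ∷ w₁ , w₂ , cong (a ∷_) eq , refl ∷ p₁ , p₂

module _ {s k : ℕ} where
  open Mult ([Fin s ]*/∼ k) renaming (_×_ to _·_)
  open Monoid ([Fin s ]*/∼ k) using (_≈_)
  private W = List (Fin s)

  -- A subword of length at most k meets at most k of the factors of a power.
  ⊑-power-collapse : ∀ (z : W) j l w → length w ≤ l → w ⊑ j · z → w ⊑ l · z
  ⊑-power-collapse z zero    l w |w|≤l []  = minimum _
  ⊑-power-collapse z (suc j) l w |w|≤l p with ++-split z p
  ... | []     , w₂ , refl , _  , p₂ = ⊑-power-collapse z j l w |w|≤l p₂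
  ⊑-power-collapse z (suc j) (suc l) w (s≤s |w|≤l) p | a ∷ w₁ , w₂ , refl , p₁ , p₂ =
    ++⁺ p₁ (⊑-power-collapse z j l w₂
      (ℕ.m+n≤o⇒n≤o (length w₁) (ℕ.≤-trans (ℕ.≤-reflexive (sym (length-++ w₁))) |w|≤l)) p₂)

  ·-mono-⊑ : ∀ (z : W) {m n} → m ≤ n → m · z ⊑ n · z
  ·-mono-⊑ z z≤n       = minimum _
  ·-mono-⊑ z (s≤s m≤n) = ++⁺ (⊆-refl {x = z}) (·-mono-⊑ z m≤n)

  -- The squeeze behind all identities below: a short subword of `v` is one of `n · z`, and `m ≥ k`
  -- copies of `z` already contain it.
  ≈-power : ∀ (z v : W) {m n} → k ≤ m → m · z ⊑ v → v ⊑ n · z → m · z ≈ v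
  ≈-power z v {m} {n} k≤m zᵐ⊑v v⊑zⁿ w |w|≤k = mk⇔
    (λ p → ⊆-trans p zᵐ⊑v)
    (λ p → ⊑-power-collapse z n m w (ℕ.≤-trans |w|≤k k≤m) (⊆-trans p v⊑zⁿ))

  power-snoc : ∀ (z : W) m → m · z ++ z ≡ z ++ m · z
  power-snoc z zero    = sym (++-identityʳ z)
  power-snoc z (suc m) = trans (++-assoc z (m · z) z) (cong (z ++_) (power-snoc z m))

  quotient-¬¬-𝐉 : (fin : IsFinite ([Fin s ]*/∼ k)) → ¬ ¬ 𝐉 (mkFiniteMonoid ([Fin s ]*/∼ k) fin)
  quotient-¬¬-𝐉 fin = ¬¬-map (λ (ω , exp , least) → ω , (exp , least) , law ω exp)
    -- `suc k` is positive even for `k = 0`, and all powers from the `k`-th on agree.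
    (¬¬-least {P = IsIdempotentExponent M} (suc k) (s≤s z≤n , λ x →
      ≈-power x ((2 * suc k) · x) {n = 2 * suc k} (ℕ.n≤1+n k)
        (·-mono-⊑ x (ℕ.m≤n*m (suc k) 2)) ⊆-refl))
    where
    M = mkFiniteMonoid ([Fin s ]*/∼ k) fin
    open Monoid ([Fin s ]*/∼ k) using (∙-congʳ; ∙-congˡ) renaming (trans to ≈-trans; sym to ≈-sym)

    -- The least exponent may lie below `k`, out of reach of `≈-power`. Since `ω · x` is idempotent,
    -- it equals its own (k + 1)-st power, whose exponent is large enough.
    large : ∀ ω → IsIdempotentExponent M ω → ∃ λ e → k ≤ e × (∀ x → ω · x ≈ e · x)
    large ω (ω>0 , idem) = suc k * ω
      , ℕ.≤-trans (ℕ.n≤1+n k) (ℕ.m≤m*n (suc k) ω {{>-nonZero ω>0}})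
      , λ x → ≈-trans (≈-sym (×-idem (ωx-idem x) (suc k))) (×-assocˡ x (suc k) ω)
      where
      ωx-idem : ∀ x → ω · x ++ ω · x ≈ ω · x
      ωx-idem x = ≈-trans (≈-sym (×-homo-+ x ω ω))
        (≈-trans (∼-reflexive (cong (λ m → (ω + m) · x) (sym (ℕ.+-identityʳ ω)))) (≈-sym (idem x)))

    law : ∀ ω → IsIdempotentExponent M ω → ∀ x y →
      (ω · (x ++ y) ≈ ω · (x ++ y) ++ x) × (ω · (x ++ y) ++ x ≈ y ++ ω · (x ++ y))
    law ω exp x y with e , k≤e , eq ← large ω exp =
      ≈-trans zʷ≈zᵉ (≈-trans zᵉ≈zᵉx (∙-congʳ {x = x} (≈-sym zʷ≈zᵉ)))
      , ≈-trans (∙-congʳ {x = x} zʷ≈zᵉ) (≈-trans (≈-sym zᵉ≈zᵉx)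
          (≈-trans zᵉ≈yzᵉ (∙-congˡ {x = y} (≈-sym zʷ≈zᵉ))))
      where
      z = x ++ y
      zʷ≈zᵉ = eq z
      -- This word and the next are squeezed between the powers e and e + 1 of `z`, as `x` is a
      -- prefix and `y` a suffix of `z`.
      zᵉ≈zᵉx : e · z ≈ e · z ++ x
      zᵉ≈zᵉx = ≈-power z _ {n = suc e} k≤e (++⁺ʳ x ⊆-refl)
        (subst (e · z ++ x ⊑_) (power-snoc z e) (++⁺ (⊆-refl {x = e · z}) (++⁺ʳ y ⊆-refl)))
      zᵉ≈yzᵉ : e · z ≈ y ++ e · z
      zᵉ≈yzᵉ = ≈-power z _ {n = suc e} k≤e (++⁺ˡ y ⊆-refl) (++⁺ (++⁺ˡ x (⊆-refl {x = y})) ⊆-refl)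

-- Counting

-- Pigeonhole: were every value hit, the preimages would inject `Fin n` into `Fin c`.
unhit : ∀ {c n} → c < n → (f : Fin c → Fin n) → ∃ λ y → ∀ x → f x ≢ y
unhit {n = n} c<n f
  with y , missed ← ¬∀⟶∃¬ n (λ y → ∃ λ x → f x ≡ y) (λ y → any? λ x → f x ≟ y)
         (λ hit → <⇒notInjective {f = proj₁ ∘ hit} c<n
           λ {y} {y′} eq → trans (sym (proj₂ (hit y))) (trans (cong f eq) (proj₂ (hit y′))))
  = y , λ x eq → missed (x , eq)

-- A number below `2 ^ n` missed by all codes is decoded. The bound stands inside the result so that
-- `σ` exists whether or not it holds.
diagonal : ∀ {c n} (g : Fin c → Fin n → Fin 2) → ∃ λ σ → c < 2 ^ n → ∀ x → ¬ (g x ≗ σ)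
diagonal {c} {n} g with c <? 2 ^ n
... | no  c≮2ⁿ = (λ _ → zero) , λ c<2ⁿ → contradiction c<2ⁿ c≮2ⁿ
... | yes c<2ⁿ with y , fresh ← unhit c<2ⁿ (funToFin ∘ g) = finToFun y , λ _ x eq →
  fresh x (trans (funToFin-cong eq) (funToFin-finToFin {n} y))

-- Oblivious branching programs

module _ (m n : ℕ) where
  -- An instruction reads a position of the input and maps the m states to
  -- themselves depending on the bit found there; a code adds to ℓ instructions
  -- an initial state and the set of accepting states.

  symbols : ℕ
  symbols = n * (m ^ m) ^ 2

  codes : ℕ → ℕ
  codes ℓ = m * (2 ^ m * symbols ^ ℓ)

module _ {m n : ℕ} where

  apply : Vec (Fin 2) n → Fin n × Fin ((m ^ m) ^ 2) → Fin m → Fin m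
  apply w (i , e) = finToFun (finToFun {m ^ m} {2} e (lookup w i))

  step : Vec (Fin 2) n → Fin (symbols m n) → Fin m → Fin m
  step w k = apply w (Fin.remQuot {n} _ k)

  encodeStep : Fin n → (Fin 2 → Fin m → Fin m) → Fin (symbols m n)
  encodeStep i δ = combine i (funToFin (funToFin ∘ δ))

  step-encodeStep : ∀ w i δ x → step w (encodeStep i δ) x ≡ δ (lookup w i) x
  step-encodeStep w i δ x = begin
    step w (encodeStep i δ) x
      ≡⟨ cong (λ ie → apply w ie x) (remQuot-combine {n} i _) ⟩
    finToFun (finToFun (funToFin (funToFin ∘ δ)) (lookup w i)) x
      ≡⟨ cong (λ k → finToFun k x) (finToFun-funToFin (funToFin ∘ δ) (lookup w i)) ⟩
    finToFun (funToFin (δ (lookup w i))) x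
      ≡⟨ finToFun-funToFin (δ (lookup w i)) x ⟩
    δ (lookup w i) x ∎
    where open ≡-Reasoning

  -- The last instruction acts first, like the right fold in run.
  steps : ∀ {ℓ} → Vec (Fin 2) n → (Fin ℓ → Fin (symbols m n)) → Fin m → Fin m
  steps {zero}  w p x = x
  steps {suc ℓ} w p x = step w (p zero) (steps w (p ∘ suc) x)

  steps-cong : ∀ {ℓ} w {p p′ : Fin ℓ → _} → p ≗ p′ → ∀ x → steps w p x ≡ steps w p′ x
  steps-cong {zero}  w p≗p′ x = refl
  steps-cong {suc ℓ} w p≗p′ x = cong₂ (step w) (p≗p′ zero) (steps-cong w (p≗p′ ∘ suc) x)

  conclude : ∀ ℓ → Vec (Fin 2) n → Fin m → Fin (2 ^ m) × Fin (symbols m n ^ ℓ) → Fin 2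
  conclude ℓ w x (accept , p) = finToFun accept (steps {ℓ} w (finToFun p) x)

  decide : ∀ ℓ → Fin (codes m n ℓ) → Vec (Fin 2) n → Fin 2
  decide ℓ c w =
    let x , c′ = Fin.remQuot {m} _ c
    in conclude ℓ w x (Fin.remQuot {2 ^ m} _ c′)

  encode : ∀ ℓ → Fin m → (Fin m → Fin 2) → (Fin ℓ → Fin (symbols m n)) → Fin (codes m n ℓ)
  encode ℓ x accept p = combine x (combine (funToFin accept) (funToFin p))

  decide-encode : ∀ ℓ x accept p w → decide ℓ (encode ℓ x accept p) w ≡ accept (steps w p x)
  decide-encode ℓ x accept p w = begin
    decide ℓ (encode ℓ x accept p) w
      ≡⟨ cong (λ (x , c) → conclude ℓ w x (Fin.remQuot {2 ^ m} (symbols m n ^ ℓ) c))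
              (remQuot-combine {m} x (combine (funToFin accept) (funToFin p))) ⟩
    conclude ℓ w x (Fin.remQuot {2 ^ m} (symbols m n ^ ℓ) (combine (funToFin accept) (funToFin p)))
      ≡⟨ cong (conclude ℓ w x) (remQuot-combine (funToFin accept) (funToFin p)) ⟩
    finToFun (funToFin accept) (steps {ℓ} w (finToFun (funToFin p)) x)
      ≡⟨ finToFun-funToFin accept _ ⟩
    accept (steps {ℓ} w (finToFun (funToFin p)) x)
      ≡⟨ cong accept (steps-cong w (finToFun-funToFin p) x) ⟩
    accept (steps w p x) ∎
    where open ≡-Reasoning

  module Simulation (M : FiniteMonoid) (size≤m : proj₁ (FiniteMonoid.finite M) ≤ m) where
    open FiniteMonoid M using (Carrier; _≈_; _∙_; ε; finite; ∙-congˡ)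
      renaming (reflexive to ≈-reflexive; sym to ≈-sym; trans to ≈-trans)
    open Inverse (proj₂ finite) using (to; from; to-cong; from-cong; strictlyInverseʳ)

    state : Carrier → Fin m
    state x = inject≤ (to x) size≤m

    state-cong : ∀ {x y} → x ≈ y → state x ≡ state y
    state-cong x≈y = cong (λ i → inject≤ i size≤m) (to-cong x≈y)

    state-injective : ∀ {x y} → state x ≡ state y → x ≈ y
    state-injective {x} {y} eq = ≈-trans (≈-sym (strictlyInverseʳ x))
      (≈-trans (from-cong (inject≤-injective size≤m size≤m (to x) (to y) eq)) (strictlyInverseʳ y))

    -- A left inverse of `state`, which need not be onto; states outside its image get the default
    -- `ε`.
    element : Fin m → Carrier
    element i with any? (λ j → state (from j) ≟ i)
    ... | yes (j , _) = from j
    ... | no  _       = ε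

    element-state : ∀ x → element (state x) ≈ x
    element-state x with any? (λ j → state (from j) ≟ state x)
    ... | yes (j , eq) = state-injective eq
    ... | no  none     = contradiction (to x , state-cong (strictlyInverseʳ x)) none

    -- An instruction multiplies from the left the product of the later outputs, held in the state.
    -- Programs shorter than `ℓ` are padded with identity instructions, which must still name some
    -- position: `i₀`.
    simulate : ∀ {ℓ} → Fin n → (P : Program M 2 n) → length P ≤ ℓ → Fin ℓ → Fin (symbols m n)
    simulate i₀ []            _           _       = encodeStep i₀ (λ _ x → x)
    simulate i₀ ((i , f) ∷ P) (s≤s _)     zero    = encodeStep i (λ a x → state (f a ∙ element x))
    simulate i₀ (_ ∷ P)       (s≤s |P|≤ℓ) (suc j) = simulate i₀ P |P|≤ℓ j

    steps-simulate : ∀ {ℓ} i₀ P (|P|≤ℓ : length P ≤ ℓ) w →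
                     steps w (simulate i₀ P |P|≤ℓ) (state ε) ≡ state (run M 2 n P w)
    steps-simulate {zero}  i₀ []            _           w = refl
    steps-simulate {suc ℓ} i₀ []            |P|≤ℓ       w =
      trans (step-encodeStep w i₀ (λ _ x → x) _) (steps-simulate {ℓ} i₀ [] z≤n w)
    steps-simulate {suc ℓ} i₀ ((i , f) ∷ P) (s≤s |P|≤ℓ) w =
      trans (step-encodeStep w i (λ a x → state (f a ∙ element x)) _) (state-cong (∙-congˡ (≈-trans
        (≈-reflexive (cong element (steps-simulate i₀ P |P|≤ℓ w)))
        (element-state _))))

    -- `F` may be undecidable, so a state is accepted when some word with `σ` equal to 1 ends in it,
    -- which is a finite search. This is consistent: words ending in the same state have equivalent
    -- products, and `F` respects `_≈_`.
    recognised⇒decided : ∀ {ℓ T} → Fin n → (P : Program M 2 n) → length P ≤ ℓ →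
      (F : Carrier → Set) → F Respects _≈_ → (word : Fin T → Vec (Fin 2) n) (σ : Fin T → Fin 2) →
      (∀ t → σ t ≡ suc zero ⇔ F (run M 2 n P (word t))) →
      ∃ λ (c : Fin (codes m n ℓ)) → ∀ t → decide ℓ c (word t) ≡ σ t
    recognised⇒decided {ℓ} {T} i₀ P |P|≤ℓ F F-resp word σ σ⇔F =
      encode ℓ (state ε) accept (simulate i₀ P |P|≤ℓ) , λ t → trans
        (decide-encode ℓ (state ε) accept _ (word t))
        (trans (cong accept (steps-simulate i₀ P |P|≤ℓ (word t))) (accept-correct t))
      where
      result : Fin T → Fin m
      result t = state (run M 2 n P (word t))
      Accepted : Fin m → Fin T → Set
      Accepted x t = result t ≡ x × σ t ≡ suc zero
      accepted? : ∀ x t → Dec (Accepted x t)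
      accepted? x t = result t ≟ x ×-dec σ t ≟ suc zero
      accept : Fin m → Fin 2
      accept x with any? (accepted? x)
      ... | yes _ = suc zero
      ... | no  _ = zero
      accept-correct : ∀ t → accept (result t) ≡ σ t
      accept-correct t with any? (accepted? (result t)) | σ t in eq
      ... | yes _                 | suc zero = refl
      ... | no  none              | suc zero = contradiction (t , refl , eq) none
      ... | no  _                 | zero     = refl
      ... | yes (t′ , same , σt′) | zero     with () ← trans (sym eq)
        (Equivalence.from (σ⇔F t) (F-resp (state-injective same) (Equivalence.to (σ⇔F t′) σt′)))

-- Arithmetic of the counting bound

4*n≤2^n : ∀ c → 4 * (5 + c) ≤ 2 ^ (5 + c)
4*n≤2^n zero    = ℕ.m≤m+n 20 12
4*n≤2^n (suc c) = begin
  4 * (5 + suc c)            ≡⟨ cong (4 *_) (ℕ.+-suc 5 c) ⟩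
  4 * suc (5 + c)            ≡⟨ ℕ.*-suc 4 (5 + c) ⟩
  4 + 4 * (5 + c)            ≤⟨ ℕ.+-monoˡ-≤ _ (ℕ.m≤m*n 4 (5 + c)) ⟩
  4 * (5 + c) + 4 * (5 + c)  ≤⟨ ℕ.+-mono-≤ (4*n≤2^n c) (4*n≤2^n c) ⟩
  2 ^ (5 + c) + 2 ^ (5 + c)  ≡⟨ cong (_+_ (2 ^ (5 + c))) (ℕ.+-identityʳ _) ⟨
  2 ^ suc (5 + c)            ≡⟨ cong (2 ^_) (ℕ.+-suc 5 c) ⟨
  2 ^ (5 + suc c)            ∎
  where open ℕ.≤-Reasoning

codes-2^ : ∀ b ℓ → let m = 2 ^ b in
  codes m (2 ^ m) ℓ ≡ 2 ^ (b + (m + (m + b * m * 2) * ℓ))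
codes-2^ b ℓ = begin
  m * (2 ^ m * (2 ^ m * (m ^ m) ^ 2) ^ ℓ)
    ≡⟨ cong (λ x → m * (2 ^ m * (2 ^ m * x ^ 2) ^ ℓ)) (ℕ.^-*-assoc 2 b m) ⟩
  m * (2 ^ m * (2 ^ m * (2 ^ (b * m)) ^ 2) ^ ℓ)
    ≡⟨ cong (λ x → m * (2 ^ m * (2 ^ m * x) ^ ℓ)) (ℕ.^-*-assoc 2 (b * m) 2) ⟩
  m * (2 ^ m * (2 ^ m * 2 ^ (b * m * 2)) ^ ℓ)
    ≡⟨ cong (λ x → m * (2 ^ m * x ^ ℓ)) (ℕ.^-distribˡ-+-* 2 m (b * m * 2)) ⟨
  m * (2 ^ m * (2 ^ (m + b * m * 2)) ^ ℓ)
    ≡⟨ cong (λ x → m * (2 ^ m * x)) (ℕ.^-*-assoc 2 (m + b * m * 2) ℓ) ⟩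
  m * (2 ^ m * 2 ^ ((m + b * m * 2) * ℓ))
    ≡⟨ cong (m *_) (ℕ.^-distribˡ-+-* 2 m ((m + b * m * 2) * ℓ)) ⟨
  m * 2 ^ (m + (m + b * m * 2) * ℓ)
    ≡⟨ ℕ.^-distribˡ-+-* 2 b (m + (m + b * m * 2) * ℓ) ⟨
  2 ^ (b + (m + (m + b * m * 2) * ℓ)) ∎
  where
  open ≡-Reasoning
  m = 2 ^ b

n<2^n : ∀ n → n < 2 ^ n
n<2^n zero    = s≤s z≤n
n<2^n (suc n) = begin-strict
  suc n          <⟨ s≤s (n<2^n n) ⟩
  1 + 2 ^ n      ≤⟨ ℕ.+-monoˡ-≤ (2 ^ n) (ℕ.m^n>0 2 n) ⟩
  2 ^ n + 2 ^ n  ≡⟨ cong (_+_ (2 ^ n)) (ℕ.+-identityʳ (2 ^ n)) ⟨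
  2 ^ suc n      ∎
  where open ℕ.≤-Reasoning

-- With `m = 2 ^ b` the left side is at most 5 m³ 2^(md), hence at most 2^(3 + 3b + md), while the
-- exponent on the right is m + md - D².
exponent-bound : ∀ d b → let m = 2 ^ b ; D = suc d in
  3 + b * 3 + D * D < m → b + (m + (m + b * m * 2) * (m * (2 ^ m) ^ d)) < 2 ^ ((m ∸ D) * D)
exponent-bound d b large = begin-strict
  b + (m + (m + b * m * 2) * (m * (2 ^ m) ^ d))
    ≡⟨ cong (λ x → b + (m + (m + b * m * 2) * (m * x))) (ℕ.^-*-assoc 2 m d) ⟩
  b + (m + (m + b * m * 2) * (m * e))
    ≤⟨ ℕ.+-mono-≤ (ℕ.≤-trans b≤m m≤m³e) (ℕ.+-mono-≤ m≤m³e (ℕ.*-monoˡ-≤ (m * e)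
         (ℕ.+-mono-≤ (ℕ.m≤m*n m m) (ℕ.*-monoˡ-≤ 2 (ℕ.*-monoˡ-≤ m b≤m))))) ⟩
  m ^ 3 * e + (m ^ 3 * e + (m * m + m * m * 2) * (m * e))
    ≡⟨ collect m e ⟩
  5 * (m ^ 3 * e)
    ≤⟨ ℕ.*-monoˡ-≤ (m ^ 3 * e) (ℕ.m≤m+n 5 3) ⟩
  2 ^ 3 * (m ^ 3 * e)
    ≡⟨ cong (λ x → 2 ^ 3 * (x * e)) (ℕ.^-*-assoc 2 b 3) ⟩
  2 ^ 3 * (2 ^ (b * 3) * e)
    ≡⟨ ℕ.*-assoc (2 ^ 3) (2 ^ (b * 3)) e ⟨
  2 ^ 3 * 2 ^ (b * 3) * e
    ≡⟨ cong (_* e) (ℕ.^-distribˡ-+-* 2 3 (b * 3)) ⟨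
  2 ^ (3 + b * 3) * e
    ≡⟨ ℕ.^-distribˡ-+-* 2 (3 + b * 3) (m * d) ⟨
  2 ^ (3 + b * 3 + m * d)
    <⟨ ℕ.^-monoʳ-< 2 (s≤s (s≤s z≤n)) exponents ⟩
  2 ^ ((m ∸ D) * D) ∎
  where
  open ℕ.≤-Reasoning
  m = 2 ^ b
  D = suc d
  e = 2 ^ (m * d)
  instance
    m≢0 : NonZero m
    m≢0 = ℕ.m^n≢0 2 b
    e≢0 : NonZero e
    e≢0 = ℕ.m^n≢0 2 (m * d)
    m³≢0 : NonZero (m * (m * 1))
    m³≢0 = ℕ.m^n≢0 m 2
  b≤m : b ≤ m
  b≤m = ℕ.<⇒≤ (n<2^n b)
  m≤m³e : m ≤ m ^ 3 * e
  m≤m³e = ℕ.≤-trans (ℕ.m≤m*n m (m ^ 2)) (ℕ.m≤m*n (m ^ 3) e)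
  collect : ∀ m e → let m³ = m * (m * (m * 1)) in
            m³ * e + (m³ * e + (m * m + m * m * 2) * (m * e)) ≡ 5 * (m³ * e)
  collect = solve-∀
  shuffle : ∀ x y z → x + y + z ≡ x + z + y
  shuffle = solve-∀
  exponents : 3 + b * 3 + m * d < (m ∸ D) * D
  exponents = begin-strict
    3 + b * 3 + m * d                         ≡⟨ ℕ.m+n∸n≡m _ (D * D) ⟨
    3 + b * 3 + m * d + D * D ∸ D * D         ≡⟨ cong (_∸ D * D) (shuffle (3 + b * 3) (m * d) (D * D)) ⟩
    3 + b * 3 + D * D + m * d ∸ D * D         <⟨ ℕ.∸-monoˡ-< (ℕ.+-monoˡ-< (m * d) large)
                                                   (ℕ.m≤n⇒m≤n+o (m * d) (ℕ.m≤n+m (D * D) (3 + b * 3))) ⟩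
    m + m * d ∸ D * D                         ≡⟨ cong (_∸ D * D) (ℕ.*-suc m d) ⟨
    m * D ∸ D * D                             ≡⟨ ℕ.*-distribʳ-∸ D m D ⟨
    (m ∸ D) * D                               ∎

-- With m = 2^b states and n = 2^m positions every quantity is a power of two, and
-- m exceeds the exponent 3 + 3b + D² of the factors lost on the way.
counting : ∀ d m₀ → let D = suc d ; b = D * D + m₀ + 5 ; m = 2 ^ b in
  .{{_ : NonZero (2 ^ D)}} → m₀ ≤ m × codes m (2 ^ m) (m * (2 ^ m) ^ d) < 2 ^ ((2 ^ m / 2 ^ D) ^ D)
counting d m₀ = ℕ.≤-trans m₀≤b (ℕ.<⇒≤ (n<2^n b)) , (begin-strict
  codes m (2 ^ m) (m * (2 ^ m) ^ d)
    ≡⟨ codes-2^ b _ ⟩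
  2 ^ (b + (m + (m + b * m * 2) * (m * (2 ^ m) ^ d)))
    <⟨ ℕ.^-monoʳ-< 2 (s≤s (s≤s z≤n)) (exponent-bound d b large) ⟩
  2 ^ (2 ^ ((m ∸ D) * D))
    ≡⟨ cong (2 ^_) (ℕ.^-*-assoc 2 (m ∸ D) D) ⟨
  2 ^ ((2 ^ (m ∸ D)) ^ D)
    ≡⟨ cong (λ x → 2 ^ (x ^ D)) quot ⟨
  2 ^ ((2 ^ m / 2 ^ D) ^ D) ∎)
  where
  open ℕ.≤-Reasoning
  D = suc d
  -- Now `4 * b` is 3 + 3b + D² plus 2 + m₀, so `4 * b ≤ 2 ^ b` yields `large`.
  b = D * D + m₀ + 5
  m = 2 ^ b
  m₀≤b : m₀ ≤ b
  m₀≤b = ℕ.≤-trans (ℕ.m≤n+m m₀ (D * D)) (ℕ.m≤m+n (D * D + m₀) 5)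
  large : 3 + b * 3 + D * D < m
  large = begin-strict
    3 + b * 3 + D * D                 <⟨ ℕ.m<m+n _ (s≤s z≤n) ⟩
    3 + b * 3 + D * D + 1             ≤⟨ ℕ.m≤m+n _ (1 + m₀) ⟩
    3 + b * 3 + D * D + 1 + (1 + m₀)  ≡⟨ rearrange (D * D) m₀ ⟩
    4 * (5 + (D * D + m₀))            ≤⟨ 4*n≤2^n (D * D + m₀) ⟩
    2 ^ (5 + (D * D + m₀))            ≡⟨ cong (2 ^_) (ℕ.+-comm 5 (D * D + m₀)) ⟩
    m                                 ∎
    where
    rearrange : ∀ s m₀ → 3 + (s + m₀ + 5) * 3 + s + 1 + (1 + m₀) ≡ 4 * (5 + (s + m₀))
    rearrange = solve-∀
  D≤m : D ≤ m
  D≤m = ℕ.≤-trans (ℕ.m≤m*n D D) (ℕ.≤-trans (ℕ.m≤n+m (D * D) (3 + b * 3)) (ℕ.<⇒≤ large))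
  quot : 2 ^ m / 2 ^ D ≡ 2 ^ (m ∸ D)
  quot = begin-equality
    2 ^ m / 2 ^ D                ≡⟨ cong (λ x → 2 ^ x / 2 ^ D) (ℕ.m∸n+n≡m D≤m) ⟨
    2 ^ (m ∸ D + D) / 2 ^ D      ≡⟨ cong (_/ 2 ^ D) (ℕ.^-distribˡ-+-* 2 (m ∸ D) D) ⟩
    2 ^ (m ∸ D) * 2 ^ D / 2 ^ D  ≡⟨ m*n/n≡m (2 ^ (m ∸ D)) (2 ^ D) ⟩
    2 ^ (m ∸ D)                  ∎

-- Rational and natural bounds

≤ℚ⇒≤ᵘ : ∀ l s (α : ℚ) → (+ l /ℚ 1) ≤ℚ α *ℚ (+ s /ℚ 1) → mkℚᵘ (+ l) 0 ≤ᵘ toℚᵘ α *ᵘ mkℚᵘ (+ s) 0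
≤ℚ⇒≤ᵘ l s α l≤αs = begin
  mkℚᵘ (+ l) 0                 ≃⟨ ℚ.toℚᵘ-fromℚᵘ (mkℚᵘ (+ l) 0) ⟨
  toℚᵘ (+ l /ℚ 1)              ≤⟨ ℚ.toℚᵘ-mono-≤ l≤αs ⟩
  toℚᵘ (α *ℚ (+ s /ℚ 1))       ≃⟨ ℚ.toℚᵘ-homo-* α (+ s /ℚ 1) ⟩
  toℚᵘ α *ᵘ toℚᵘ (+ s /ℚ 1)    ≃⟨ ℚᵘ.*-congˡ {toℚᵘ α} (ℚ.toℚᵘ-fromℚᵘ (mkℚᵘ (+ s) 0)) ⟩
  toℚᵘ α *ᵘ mkℚᵘ (+ s) 0       ∎
  where open ℚᵘ.≤-Reasoning

i≤+∣i∣ : ∀ i → i ≤ᶻ + ∣ i ∣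
i≤+∣i∣ (+ n)      = ℤ.≤-refl
i≤+∣i∣ ℤ.-[1+ n ] = ℤ.-≤+

-- The denominator is at least 1, so dropping it only weakens the bound.
≤ℚ⇒≤ : ∀ l s (α : ℚ) → (+ l /ℚ 1) ≤ℚ α *ℚ (+ s /ℚ 1) → l ≤ ∣ ↥ α ∣ * s
≤ℚ⇒≤ l s α@(mkℚ num den-1 _) l≤αs with *≤* l*den≤num*s ← ≤ℚ⇒≤ᵘ l s α l≤αs =
  ℤ.drop‿+≤+ (begin
    + l                          ≤⟨ ℤ.+≤+ (ℕ.m≤m*n l (suc den-1 * 1)) ⟩
    + (l * (suc den-1 * 1))      ≡⟨ ℤ.pos-* l (suc den-1 * 1) ⟩
    + l ℤ.* + (suc den-1 * 1)    ≤⟨ l*den≤num*s ⟩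
    (num ℤ.* + s) ℤ.* + 1        ≡⟨ ℤ.*-identityʳ (num ℤ.* + s) ⟩
    num ℤ.* + s                  ≤⟨ ℤ.*-monoʳ-≤-nonNeg (+ s) (i≤+∣i∣ num) ⟩
    + ∣ num ∣ ℤ.* + s            ≡⟨ ℤ.pos-* ∣ num ∣ s ⟨
    + (∣ num ∣ * s)              ∎)
  where open ℤ.≤-Reasoning

≤⇒≤ℚ : ∀ l s c → l ≤ c * s → (+ l /ℚ 1) ≤ℚ (+ c /ℚ 1) *ℚ (+ s /ℚ 1)
≤⇒≤ℚ l s c le = ℚ.toℚᵘ-cancel-≤ (begin
  toℚᵘ (+ l /ℚ 1)                    ≃⟨ ℚ.toℚᵘ-fromℚᵘ (mkℚᵘ (+ l) 0) ⟩
  mkℚᵘ (+ l) 0                       ≤⟨ *≤* numerators ⟩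
  mkℚᵘ (+ c) 0 *ᵘ mkℚᵘ (+ s) 0       ≃⟨ ℚᵘ.*-cong (ℚ.toℚᵘ-fromℚᵘ (mkℚᵘ (+ c) 0))
                                                  (ℚ.toℚᵘ-fromℚᵘ (mkℚᵘ (+ s) 0)) ⟨
  toℚᵘ (+ c /ℚ 1) *ᵘ toℚᵘ (+ s /ℚ 1) ≃⟨ ℚ.toℚᵘ-homo-* (+ c /ℚ 1) (+ s /ℚ 1) ⟨
  toℚᵘ ((+ c /ℚ 1) *ℚ (+ s /ℚ 1))    ∎)
  where
  open ℚᵘ.≤-Reasoning
  numerators : + l ℤ.* + 1 ≤ᶻ (+ c ℤ.* + s) ℤ.* + 1
  numerators = ℤ.*-monoʳ-≤-nonNeg (+ 1) (ℤ.≤-trans (ℤ.+≤+ le) (ℤ.≤-reflexive (ℤ.pos-* c s)))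

0<suc/1 : ∀ c → 0ℚ <ℚ + suc c /ℚ 1
0<suc/1 c = ℚ.positive⁻¹ (+ suc c /ℚ 1) {{ℚ.normalize-pos (suc c) 1}}

-- The separating languages

𝒫-mono : ∀ {ℓ} (V : Pred FiniteMonoid ℓ) d → 𝒫 V (_^ d) ⊆ 𝒫 V (_^ suc d)
𝒫-mono V d {mkLanguage a L} (M , VM , P , rec , α , _ , |P|≤) =
  M , VM , P , rec , + suc c /ℚ 1 , 0<suc/1 c ,
  λ n → ≤⇒≤ℚ (length (P n)) (n ^ suc d) (suc c) (bound n)
  where
  c = ∣ ↥ α ∣
  bound : ∀ n → length (P n) ≤ suc c * n ^ suc d
  -- Here n ^ suc d = 0, but a program without input positions is empty.
  bound zero with P zero
  ... | []          = z≤n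
  ... | (() , _) ∷ _
  bound n@(suc _) = begin
    length (P n)        ≤⟨ ≤ℚ⇒≤ (length (P n)) (n ^ d) α (|P|≤ n) ⟩
    c * n ^ d           ≤⟨ ℕ.*-mono-≤ (ℕ.n≤1+n c) (ℕ.m≤n*m (n ^ d) n) ⟩
    suc c * n ^ suc d   ∎
    where open ℕ.≤-Reasoning

-- An equality of pairs, since the program run on a word depends on its length, which is `n` only
-- propositionally.
fromList-toList : ∀ {a} {A : Set a} {n} (w : Vec A n) →
  _≡_ {A = Σ ℕ (Vec A)} (length (toList w) , fromList (toList w)) (n , w)
fromList-toList Vec.[]      = refl
fromList-toList (x Vec.∷ w) = cong (λ (n , v) → suc n , x Vec.∷ v) (fromList-toList w)

module Separation (d : ℕ) where
  private
    D = suc d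
    instance
      2^D≢0 : NonZero (2 ^ D)
      2^D≢0 = ℕ.m^n≢0 2 D

  -- Any unbounded width would do, provided it is small against n.
  width blockLength selectorSize : ℕ → ℕ
  width n        = ⌊log₂ n ⌋
  -- As D ≤ `2 ^ D`, all D blocks fit into the input; on the powers of two used for counting the
  -- division is exact.
  blockLength n  = n / 2 ^ D
  selectorSize n = blockLength n ^ D

  D*blockLength≤n : ∀ n → D * blockLength n ≤ n
  D*blockLength≤n n = begin
    D * blockLength n       ≤⟨ ℕ.*-monoˡ-≤ (blockLength n) (ℕ.<⇒≤ (n<2^n D)) ⟩
    2 ^ D * blockLength n   ≡⟨ ℕ.*-comm (2 ^ D) (blockLength n) ⟩
    blockLength n * 2 ^ D   ≤⟨ m/n*n≤m n (2 ^ D) ⟩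
    n                       ∎
    where open ℕ.≤-Reasoning

  position : ∀ {n} → Fin D → Fin (blockLength n) → Fin n
  position {n} c i = inject≤ (combine c i) (D*blockLength≤n n)

  position-injective : ∀ {n} c i c′ i′ → position {n} c i ≡ position c′ i′ → c ≡ c′ × i ≡ i′
  position-injective {n} c i c′ i′ eq = combine-injective c i c′ i′
    (inject≤-injective (D*blockLength≤n n) (D*blockLength≤n n) _ _ eq)

  bitAt : ∀ {n} → Fin (selectorSize n) → Fin n → Fin 2
  bitAt t p with any? (λ c → position c (finToFun t c) ≟ p)
  ... | yes _ = suc zero
  ... | no  _ = zero

  word : ∀ {n} → Fin (selectorSize n) → Vec (Fin 2) n
  word t = Vec.tabulate (bitAt t)

  word-marks : ∀ {n} t → Marks (word {n} t) position t
  word-marks {n} t = record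
    { marked   = λ c → trans (lookup∘tabulate (bitAt t) _) (bit-marked c)
    ; unmarked = λ c i i≢ → trans (lookup∘tabulate (bitAt t) _) (bit-unmarked c i i≢)
    }
    where
    bit-marked : ∀ c → bitAt t (position {n} c (finToFun t c)) ≡ suc zero
    bit-marked c with any? (λ c′ → position c′ (finToFun t c′) ≟ position {n} c (finToFun t c))
    ... | yes _   = refl
    ... | no none = contradiction (c , refl) none
    bit-unmarked : ∀ c i → i ≢ finToFun t c → bitAt t (position {n} c i) ≡ zero
    bit-unmarked c i i≢ with any? (λ c′ → position c′ (finToFun t c′) ≟ position {n} c i)
    ... | no _         = refl
    ... | yes (c′ , eq) with refl , i≡ ← position-injective {n} c′ (finToFun t c′) c i eq =
      contradiction (sym i≡) i≢

  -- The unbounded factor eventually exceeds any constant in front of `n ^ d`, so one language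
  -- defeats all constants.
  budget : ℕ → ℕ
  budget n = width n * n ^ d

  Outnumbered : ℕ → Set
  Outnumbered n = codes (width n) n (budget n) < 2 ^ selectorSize n

  hardSelector : ∀ n → ∃ λ (σ : Fin (selectorSize n) → Fin 2) →
    Outnumbered n → ∀ c → ¬ (λ t → decide {width n} (budget n) c (word t)) ≗ σ
  hardSelector n = diagonal (λ c t → decide {width n} (budget n) c (word t))

  hardProgram : ∀ n → List (Fin n × (Fin 2 → List (Fin D)))
  hardProgram n = selector d position id (proj₁ (hardSelector n))

  -- Defined by its own programs, so that only the lower bound needs the marked words.
  hardLanguage : Language
  hardLanguage = mkLanguage 2 λ w → nest d id ⊑ outputs (fromList w) (hardProgram (length w))

  open Language hardLanguage using (words)

  words-toList : ∀ {n} (w : Vec (Fin 2) n) → words (toList w) ⇔ nest d id ⊑ outputs w (hardProgram n)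
  words-toList w = subst (λ (n , v) → words (toList w) ⇔ nest d id ⊑ outputs v (hardProgram n))
    (fromList-toList w) ⇔.refl

  -- Elements of the quotient are words, so `hardProgram` is already a program over it and its run
  -- is `outputs`. Containing a nest of length 2d + 1 ≤ `k` is invariant under `∼[ k ]`.
  hardLanguage-upper : ∀ {ℓ} {V : Pred FiniteMonoid ℓ} k → suc (d + d) ≤ k →
    (fin : IsFinite ([Fin D ]*/∼ k)) → V (mkFiniteMonoid ([Fin D ]*/∼ k) fin) →
    𝒫 V (_^ suc d) hardLanguage
  hardLanguage-upper k 2d<k fin VM =
    mkFiniteMonoid ([Fin D ]*/∼ k) fin , VM , hardProgram ,
    (λ n → (nest d id ⊑_) ,
      (λ {u} {v} u∼v → Equivalence.to (u∼v (nest d id)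
        (ℕ.≤-trans (ℕ.≤-reflexive (length-nest d id)) 2d<k))) ,
      words-toList) ,
    + suc (d + d) /ℚ 1 , 0<suc/1 (d + d) ,
    λ n → ≤⇒≤ℚ (length (hardProgram n)) (n ^ suc d) (suc (d + d))
      (ℕ.≤-trans (length-selector d position id (proj₁ (hardSelector n)))
        (ℕ.*-monoʳ-≤ (suc (d + d)) (ℕ.^-monoˡ-≤ (suc d) (m/n≤m n (2 ^ D)))))

  -- On marked words membership is `σ`, so a recognising program within budget would give a code for
  -- the selector that no code decides.
  hardLanguage-unrecognised : ∀ n → Fin n → Outnumbered n →
    ∀ M → proj₁ (FiniteMonoid.finite M) ≤ width n →
    ∀ P → length P ≤ budget n → ¬ Recognises M 2 n P words
  hardLanguage-unrecognised n i₀ few M size≤width P short (F , F-resp , L⇔F) =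
    let c , decided = recognised⇒decided i₀ P short F F-resp word σ σ⇔F
    in proj₂ (hardSelector n) few c decided
    where
    open Simulation {width n} {n} M size≤width
    σ = proj₁ (hardSelector n)
    σ⇔F : ∀ t → σ t ≡ suc zero ⇔ F (run M 2 n P (word t))
    σ⇔F t = ⇔.trans (⇔.sym (selector-correct d (word t) position id σ t id (word-marks t)))
      (⇔.trans (⇔.sym (words-toList (word t))) (L⇔F (word t)))

  hardLanguage-lower : ∀ {ℓ} {V : Pred FiniteMonoid ℓ} → ¬ 𝒫 V (_^ d) hardLanguage
  hardLanguage-lower (M , _ , P , recognises , α , _ , |P|≤) =
    hardLanguage-unrecognised N (fromℕ< (ℕ.m^n>0 2 m)) few
      M (ℕ.m+n≤o⇒m≤o size m₀≤width) (P N) short (recognises N)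
    where
    size = proj₁ (FiniteMonoid.finite M)
    c = ∣ ↥ α ∣
    -- Bounds both the number of states and the constant of the length.
    m₀ = size + c
    m = 2 ^ (D * D + m₀ + 5)
    N = 2 ^ m
    width≡m : width N ≡ m
    width≡m = ⌊log₂[2^n]⌋≡n m
    m₀≤width : m₀ ≤ width N
    m₀≤width = ℕ.≤-trans (proj₁ (counting d m₀)) (ℕ.≤-reflexive (sym width≡m))
    few : Outnumbered N
    few = subst (λ x → codes x N (x * N ^ d) < 2 ^ selectorSize N) (sym width≡m)
      (proj₂ (counting d m₀))
    short : length (P N) ≤ budget N
    short = ℕ.≤-trans (≤ℚ⇒≤ (length (P N)) (N ^ d) α (|P|≤ N))
      (ℕ.*-monoˡ-≤ (N ^ d) (ℕ.m+n≤o⇒n≤o size m₀≤width))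

-- Strictness is a negation, so finiteness of the quotient and its membership in `V` are available
-- from their double negations. The alphabet has one letter per coordinate.
separation : ∀ {ℓ} (V : Pred FiniteMonoid ℓ) d k → suc (d + d) ≤ k →
  (∀ fin → ¬ ¬ V (mkFiniteMonoid ([Fin suc d ]*/∼ k) fin)) →
  𝒫 V (_^ d) ⊂ 𝒫 V (_^ suc d)
separation V d k 2d<k V∋ = (λ {L} → 𝒫-mono V d {L}) , λ collapse →
  quotient-¬¬-finite (suc d) k λ fin → V∋ fin λ VM →
    hardLanguage-lower (collapse {hardLanguage} (hardLanguage-upper k 2d<k fin VM))
  where open Separation d

-- Turns the bound on d into the length condition 2d + 1 ≤ `k` on nests.
<⌈/2⌉⇒2*< : ∀ k {d} → d < ⌈ k /2⌉ → d + d < k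
<⌈/2⌉⇒2*< (suc zero)    {zero}  _         = s≤s z≤n
<⌈/2⌉⇒2*< (suc (suc k)) {zero}  _         = s≤s z≤n
<⌈/2⌉⇒2*< (suc zero)    {suc d} (s≤s ())
<⌈/2⌉⇒2*< (suc (suc k)) {suc d} (s≤s d<) =
  s≤s (ℕ.≤-trans (s≤s (ℕ.≤-reflexive (ℕ.+-suc d d))) (s≤s (<⌈/2⌉⇒2*< k d<)))

-- Subtraction is over the integers, so `c = 0` admits no `d` and its case is absurd.
≤-1⇒< : ∀ {d} c → + d ≤ᶻ + c - 1ℤ → d < c
≤-1⇒< (suc c) (ℤ.+≤+ d≤c) = s≤s d≤c

proposition3p3 : (∀ (k : ℕ) → 𝒫 𝐉 (λ n → n ^ k) ⊂ 𝒫 𝐉 (λ n → n ^ suc k))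
    × (∀ (k d : ℕ) → + d ≤ᶻ + ⌈ k /2⌉ - 1ℤ →
    𝒫 𝐉[ k ] (λ n → n ^ d) ⊂ 𝒫 𝐉[ k ] (λ n → n ^ suc d))
proposition3p3 =
  -- In `𝐉` the subword length is free: 2k + 1 is exactly the length of the nest.
  (λ k → separation 𝐉 k (suc (k + k)) ℕ.≤-refl quotient-¬¬-𝐉) ,
  (λ k d d≤ → separation 𝐉[ k ] d k (<⌈/2⌉⇒2*< k (≤-1⇒< ⌈ k /2⌉ d≤))
    λ fin none → none (quotient (suc d) fin))
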